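{- There is an absolute constant $K>0$ such that for every integer $n\ge 1$, if $C=(U,V;E)$ is the crown graph on $2n$ vertices with $|U|=|V|=n$, then in the random order model the expected number of colors used by FirstFit on $C$ is at most $2.5+\dfrac{K}{n}$.
   Context: Crown graph on $2n$ vertices: the undirected bipartite graph $C=(U,V;E)$ with vertex classes $U=\{u_1,\ldots,u_n\}$ and $V=\{v_1,\ldots,v_n\}$ (disjoint), with an edge between $u_i$ and $v_j$ exactly when $i\ne j$, and no other edges. FirstFit: given a finite simple graph and an ordering of its vertices, the vertices are processed in that order, and each vertex irrevocably receives the smallest positive integer (color) that is not the color of any of its neighbors processed earlier. The number of colors used is the number of distinct colors assigned. Random order model: the graph is fixed and the ordering of its vertices is chosen uniformly at random among all orderings; the expectation is over this choice. -}

module Defs where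

open import Data.Empty using (⊥)
open import Data.Fin using (Fin; toℕ; fromℕ; fromℕ<)
import Data.Fin.Properties as Fin
open import Data.Integer using (+_)
open import Data.List using (List; []; _∷_; length; map; filter; deduplicate; concatMap; allFin)
open import Data.List.Extrema.Nat using (max; xs≤max)
open import Data.List.Membership.Propositional using (_∈_; _∉_)
open import Data.Nat.ListAction using (sum)
open import Data.List.Properties using (length-map; length-++; length-tabulate)
import Data.List.Relation.Unary.All as All
open import Data.Nat using (ℕ; zero; suc; _+_; _*_; _≤_; _<_; s≤s; s<s⁻¹; z≤n; NonZero; _!)
open import Data.Nat.Properties using (_≟_; _!≢0; <-irrefl)
open import Data.List.Membership.DecPropositional _≟_ using (_∈?_)
open import Data.Product using (_×_; _,_; proj₁; proj₂)
open import Data.Rational using (ℚ; _/_)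
open import Data.Sum using (_⊎_; inj₁; inj₂)
open import Data.Vec using (Vec; []; _∷_; lookup; removeAt; tabulate; toList)
open import Function using (_∘_; _↔_; Inverse)
open import Relation.Binary using (Rel; Decidable; Symmetric; Irreflexive)
open import Relation.Binary.PropositionalEquality using (_≡_; _≢_; refl; sym; trans; cong; cong₂; subst)
open import Relation.Nullary using (¬_; no)
open import Relation.Nullary.Decidable using (¬?)
open import Level using (0ℓ)

record FiniteSimpleGraph : Set₁ where
  field
    Vertex      : Set
    order       : ℕ
    enumeration : Fin order ↔ Vertex
    Adj         : Rel Vertex 0ℓ
    adj?        : Decidable Adj
    adj-sym     : Symmetric Adj
    adj-irrefl  : Irreflexive _≡_ Adj

  vertices : Vec Vertex order
  vertices = tabulate (Inverse.to enumeration)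

CrownAdj : (n : ℕ) → Rel (Fin n ⊎ Fin n) 0ℓ
CrownAdj n (inj₁ i) (inj₁ j) = ⊥
CrownAdj n (inj₁ i) (inj₂ j) = i ≢ j
CrownAdj n (inj₂ i) (inj₁ j) = i ≢ j
CrownAdj n (inj₂ i) (inj₂ j) = ⊥

crownAdj? : (n : ℕ) → Decidable (CrownAdj n)
crownAdj? n (inj₁ i) (inj₁ j) = no λ ()
crownAdj? n (inj₁ i) (inj₂ j) = ¬? (i Fin.≟ j)
crownAdj? n (inj₂ i) (inj₁ j) = ¬? (i Fin.≟ j)
crownAdj? n (inj₂ i) (inj₂ j) = no λ ()

crownAdj-sym : (n : ℕ) → Symmetric (CrownAdj n)
crownAdj-sym n {inj₁ i} {inj₂ j} i≢j = i≢j ∘ sym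
crownAdj-sym n {inj₂ i} {inj₁ j} i≢j = i≢j ∘ sym

crownAdj-irrefl : (n : ℕ) → Irreflexive _≡_ (CrownAdj n)
crownAdj-irrefl n {inj₁ i} refl ()
crownAdj-irrefl n {inj₂ i} refl ()

-- u_i is inj₁ i and v_j is inj₂ j.
crown : ℕ → FiniteSimpleGraph
crown n = record
  { Vertex      = Fin n ⊎ Fin n
  ; order       = n + n
  ; enumeration = Fin.+↔⊎
  ; Adj         = CrownAdj n
  ; adj?        = crownAdj? n
  ; adj-sym     = λ {x} {y} → crownAdj-sym n {x} {y}
  ; adj-irrefl  = crownAdj-irrefl n
  }

record LeastAbsent (xs : List ℕ) : Set where
  field
    value    : ℕ
    positive : 1 ≤ value
    absent   : value ∉ xs
    least    : ∀ d → 1 ≤ d → d < value → d ∈ xs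

leastAbsent : (xs : List ℕ) → LeastAbsent xs
leastAbsent xs
  with Fin.¬∀⟶∃¬-smallest (suc (max 0 xs)) (λ i → suc (toℕ i) ∈ xs) (λ i → suc (toℕ i) ∈? xs) notAll
  where
  notAll : ¬ ((i : Fin (suc (max 0 xs))) → suc (toℕ i) ∈ xs)
  notAll all = <-irrefl refl
    (subst (λ m → suc m ≤ max 0 xs) (Fin.toℕ-fromℕ (max 0 xs))
      (All.lookup (xs≤max 0 xs) (all (fromℕ (max 0 xs)))))
... | i , absent , below = record
  { value    = suc (toℕ i)
  ; positive = s≤s z≤n
  ; absent   = absent
  ; least    = λ where
      (suc d) _ d<i → subst (λ k → suc k ∈ xs)
        (trans (Fin.toℕ-inject (fromℕ< (s<s⁻¹ d<i))) (Fin.toℕ-fromℕ< (s<s⁻¹ d<i)))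
        (below (fromℕ< (s<s⁻¹ d<i)))
  }

module _ (G : FiniteSimpleGraph) where
  open FiniteSimpleGraph G

  -- The first argument holds the vertices already processed, with their colours.
  firstFitFrom : List (Vertex × ℕ) → List Vertex → List (Vertex × ℕ)
  firstFitFrom processed []       = processed
  firstFitFrom processed (v ∷ vs) = firstFitFrom ((v , colour) ∷ processed) vs
    where
    neighbourColours : List ℕ
    neighbourColours = map proj₂ (filter (λ p → adj? v (proj₁ p)) processed)

    colour : ℕ
    colour = LeastAbsent.value (leastAbsent neighbourColours)

  firstFit : List Vertex → List (Vertex × ℕ)
  firstFit = firstFitFrom []

  coloursUsed : List Vertex → ℕ
  coloursUsed vs = length (deduplicate _≟_ (map proj₂ (firstFit vs)))

-- Every arrangement of the entries, obtained by choosing the first entry in all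
-- possible ways and then arranging the others.
orderings : {A : Set} {m : ℕ} → Vec A m → List (Vec A m)
orderingsFrom : {A : Set} {m : ℕ} → Vec A (suc m) → Fin (suc m) → List (Vec A (suc m))

orderings {m = zero}  []  = [] ∷ []
orderings {m = suc m} xs = concatMap (orderingsFrom xs) (allFin (suc m))

orderingsFrom xs i = map (lookup xs i ∷_) (orderings (removeAt xs i))

length-concatMap-const : {A B : Set} (f : A → List B) (k : ℕ) → (∀ x → length (f x) ≡ k) →
                         (xs : List A) → length (concatMap f xs) ≡ length xs * k
length-concatMap-const f k eq []       = refl
length-concatMap-const f k eq (x ∷ xs) =
  trans (length-++ (f x)) (cong₂ _+_ (eq x) (length-concatMap-const f k eq xs))

length-orderings : {A : Set} {m : ℕ} (xs : Vec A m) → length (orderings xs) ≡ m !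
length-orderings {m = zero}  []  = refl
length-orderings {m = suc m} xs = trans
  (length-concatMap-const (orderingsFrom xs) (m !)
    (λ i → trans (length-map (lookup xs i ∷_) (orderings (removeAt xs i))) (length-orderings (removeAt xs i)))
    (allFin (suc m)))
  (cong (_* m !) (length-tabulate {n = suc m} (λ i → i)))

mean : {A : Set} → (A → ℕ) → (xs : List A) → .{{NonZero (length xs)}} → ℚ
mean f xs = + sum (map f xs) / length xs

expectedColours : FiniteSimpleGraph → ℚ
expectedColours G = mean (coloursUsed G ∘ toList) (orderings vertices) {{nonEmpty}}
  where
  open FiniteSimpleGraph G

  nonEmpty : NonZero (length (orderings vertices))
  nonEmpty = subst NonZero (sym (length-orderings vertices)) (order !≢0)

{-# OPTIONS --safe #-}

-- Reveal the ordering one vertex at a time and follow the mean of the final number of colours.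
-- Once two vertices of one side carry the largest colour c of that side, and the other side uses only
-- colours at most c + 1 and different from c, this stays so. The run is undecided only along a few shapes:
--   u_i = 1;   u_i = 1, v_j = 2;   u_i = v_i = 1;   ..., u_k = 2;   ..., u_k = 2, v_l = 3.
-- From u_i = 1, v_j = 2 the next vertex decides for 2 colours if it is a u and for at most 3 if it is a v,
-- whence 5/2. Meeting the mate of an unmatched vertex has probability O(1/n): the first time it costs
-- a bounded mean, and the second time the trivial bound 2n is affordable.

module Submission where

open import Defs
open import Data.Fin using (Fin; zero; suc; splitAt; join)
import Data.Fin.Properties as Fin
open import Data.Integer using (+_)
import Data.Integer as ℤ
import Data.Integer.Properties as ℤ
open import Data.List using (List; []; _∷_; length; map; filter; deduplicate; concatMap; allFin; applyUpTo)
import Data.List as List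
open import Data.List.Membership.Propositional using (_∈_; _∉_)
open import Data.List.Membership.Propositional.Properties
  using (∈-deduplicate⁺; ∈-deduplicate⁻; ∈-map∘filter⁺; ∈-map∘filter⁻; ∈-map⁻; ∈-filter⁺; ∈-applyUpTo⁺)
open import Data.List.Properties
  using (length-deduplicate; length-map; filter-accept; filter-reject; filter-notAll; map-∘;
         map-tabulate; map-++; tabulate-cong; length-applyUpTo)
open import Data.List.Relation.Binary.Permutation.Propositional using (_↭_; prep; swap; ↭-refl; ↭-sym)
import Data.List.Relation.Binary.Permutation.Propositional.Properties as Perm
open import Data.List.Relation.Binary.Subset.Propositional using (_⊆_)
open import Data.List.Relation.Unary.All using (All; []; _∷_)
import Data.List.Relation.Unary.All as All
open import Data.List.Relation.Unary.AllPairs using ([]; _∷_)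
open import Data.List.Relation.Unary.Any using (here; there)
import Data.List.Relation.Unary.Any as Any
open import Data.List.Relation.Unary.Unique.Propositional using (Unique)
open import Data.Nat using (ℕ; zero; suc; _!; z≤n; s≤s; NonZero)
  renaming (_+_ to _+ℕ_; _*_ to _*ℕ_; _≤_ to _≤ℕ_)
open import Data.Nat.ListAction using (sum)
open import Data.Nat.ListAction.Properties using (sum-++; sum-↭)
import Data.Nat.Properties as ℕ
open import Data.List.Relation.Unary.Unique.DecPropositional.Properties ℕ._≟_ using (deduplicate-!)
open import Data.Nat.Tactic.RingSolver using (solve-∀)
open import Data.Product using (Σ-syntax; _×_; _,_; proj₁; proj₂)
open import Data.Rational using (ℚ; 0ℚ; toℚᵘ; _/_; _+_; _*_; _≤_; _<_)
import Data.Rational.Properties as ℚ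
open import Data.Rational.Unnormalised using (mkℚᵘ; *≤*)
import Data.Rational.Unnormalised as ℚᵘ
import Data.Rational.Unnormalised.Properties as ℚᵘ
open import Data.Sum using (_⊎_; inj₁; inj₂)
import Data.Sum as Sum
open import Data.Sum.Properties using (inj₁-injective; inj₂-injective; ≡-dec)
open import Data.Vec using (Vec; []; _∷_; lookup; removeAt; toList; tabulate)
import Data.Vec as Vec
import Data.Vec.Properties as Vec
open import Function using (_∘_; id; const)
open import Relation.Binary.PropositionalEquality
  using (_≡_; _≢_; refl; sym; trans; cong; cong₂; subst; module ≡-Reasoning)
open import Relation.Nullary using (¬_; Dec; yes; no; contradiction)
open import Relation.Nullary.Decidable using (¬?; True; False; toWitness; toWitnessFalse)

private variable
  A : Set
  m : ℕ

-- Distinct colours and the least absent colour.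

unique-⊆⇒length≤ : {xs ys : List ℕ} → Unique xs → xs ⊆ ys → length xs ≤ℕ length ys
unique-⊆⇒length≤ []          xs⊆ys = z≤n
unique-⊆⇒length≤ {x ∷ xs} {ys} (x∉xs ∷ unique) xs⊆ys = begin-strict
  length xs                            ≤⟨ unique-⊆⇒length≤ unique xs⊆ys-x ⟩
  length (filter (¬? ∘ (x ℕ.≟_)) ys)   <⟨ filter-notAll (¬? ∘ (x ℕ.≟_)) ys (Any.map (λ x≡y x≢y → x≢y x≡y) (xs⊆ys (here refl))) ⟩
  length ys                            ∎
  where
  open ℕ.≤-Reasoning
  xs⊆ys-x : xs ⊆ filter (¬? ∘ (x ℕ.≟_)) ys
  xs⊆ys-x y∈xs = ∈-filter⁺ (¬? ∘ (x ℕ.≟_)) (xs⊆ys (there y∈xs)) (All.lookup x∉xs y∈xs)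

distinct : List ℕ → ℕ
distinct xs = length (deduplicate ℕ._≟_ xs)

distinct-⊆ : {xs ys : List ℕ} → xs ⊆ ys → distinct xs ≤ℕ distinct ys
distinct-⊆ {xs} xs⊆ys = unique-⊆⇒length≤ (deduplicate-! xs)
  (∈-deduplicate⁺ ℕ._≟_ ∘ xs⊆ys ∘ ∈-deduplicate⁻ ℕ._≟_ xs)

distinct-≤ : {xs : List ℕ} (c : ℕ) → (∀ {d} → d ∈ xs → 1 ≤ℕ d × d ≤ℕ c) → distinct xs ≤ℕ c
distinct-≤ {xs} c range = subst (distinct xs ≤ℕ_) (length-applyUpTo suc c)
  (unique-⊆⇒length≤ (deduplicate-! xs) (within ∘ ∈-deduplicate⁻ ℕ._≟_ xs))
  where
  within : ∀ {d} → d ∈ xs → d ∈ applyUpTo suc c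
  within {zero}  d∈xs = contradiction (proj₁ (range d∈xs)) λ ()
  within {suc d} d∈xs = ∈-applyUpTo⁺ suc (proj₂ (range d∈xs))

leastAbsentColour : List ℕ → ℕ
leastAbsentColour = LeastAbsent.value ∘ leastAbsent

leastAbsentColour-≤ : ∀ xs {c} → 1 ≤ℕ c → c ∉ xs → leastAbsentColour xs ≤ℕ c
leastAbsentColour-≤ xs {c} 1≤c c∉xs =
  ℕ.≮⇒≥ (c∉xs ∘ LeastAbsent.least (leastAbsent xs) c 1≤c)

-- The least absent value depends only on which values occur. This is what lets a state be reordered
-- later on.
leastAbsentColour-↭ : ∀ {xs ys} → xs ↭ ys → leastAbsentColour xs ≡ leastAbsentColour ys
leastAbsentColour-↭ {xs} {ys} xs↭ys = ℕ.≤-antisym (lower xs↭ys) (lower (↭-sym xs↭ys))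
  where
  lower : ∀ {xs ys} → xs ↭ ys → leastAbsentColour xs ≤ℕ leastAbsentColour ys
  lower {xs} {ys} p = leastAbsentColour-≤ xs positive (absent ∘ Perm.∈-resp-↭ p)
    where open LeastAbsent (leastAbsent ys)

-- Sums of a weight function over a vector.

𝟙 : {P : Set} → Dec P → ℕ
𝟙 (yes _) = 1
𝟙 (no  _) = 0

weight : (A → ℕ) → Vec A m → ℕ
weight w xs = Vec.sum (Vec.map w xs)

weight-removeAt : (w : A → ℕ) (xs : Vec A (suc m)) (i : Fin (suc m)) →
                  weight w xs ≡ w (lookup xs i) +ℕ weight w (removeAt xs i)
weight-removeAt w (x ∷ xs)         zero    = refl
weight-removeAt w (x ∷ xs@(_ ∷ _)) (suc i) = begin
  w x +ℕ weight w xs                                        ≡⟨ cong (w x +ℕ_) (weight-removeAt w xs i) ⟩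
  w x +ℕ (w (lookup xs i) +ℕ weight w (removeAt xs i))      ≡⟨ solve (w x) (w (lookup xs i)) _ ⟩
  w (lookup xs i) +ℕ (w x +ℕ weight w (removeAt xs i))      ∎
  where
  open ≡-Reasoning
  solve : ∀ a b c → a +ℕ (b +ℕ c) ≡ b +ℕ (a +ℕ c)
  solve = solve-∀

weight-+ : (v w : A → ℕ) (xs : Vec A m) → weight (λ x → v x +ℕ w x) xs ≡ weight v xs +ℕ weight w xs
weight-+ v w []       = refl
weight-+ v w (x ∷ xs) = trans (cong (v x +ℕ w x +ℕ_) (weight-+ v w xs)) (solve (v x) (w x) _ _)
  where
  solve : ∀ a b c d → a +ℕ b +ℕ (c +ℕ d) ≡ a +ℕ c +ℕ (b +ℕ d)
  solve = solve-∀

weight-* : (c : ℕ) (w : A → ℕ) (xs : Vec A m) → weight (λ x → c *ℕ w x) xs ≡ c *ℕ weight w xs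
weight-* c w []       = sym (ℕ.*-zeroʳ c)
weight-* c w (x ∷ xs) = trans (cong (c *ℕ w x +ℕ_) (weight-* c w xs)) (sym (ℕ.*-distribˡ-+ c (w x) _))

weight-const : (c : ℕ) (xs : Vec A m) → weight (const c) xs ≡ m *ℕ c
weight-const c []       = refl
weight-const c (x ∷ xs) = cong (c +ℕ_) (weight-const c xs)

weight-tabulate-splitAt : ∀ m {k} (w : Fin m ⊎ Fin k → ℕ) →
  weight w (tabulate (splitAt m)) ≡ weight (w ∘ inj₁) (tabulate id) +ℕ weight (w ∘ inj₂) (tabulate id)
weight-tabulate-splitAt zero    w = cong Vec.sum (begin
  Vec.map w (tabulate inj₂)           ≡⟨ Vec.tabulate-∘ w inj₂ ⟨
  tabulate (w ∘ inj₂)                 ≡⟨ Vec.tabulate-∘ (w ∘ inj₂) id ⟩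
  Vec.map (w ∘ inj₂) (tabulate id)    ∎)
  where open ≡-Reasoning
weight-tabulate-splitAt (suc m) {k} w = begin
  w₀ +ℕ weight w (tabulate (shift ∘ splitAt m))                          ≡⟨ cong (w₀ +ℕ_) (push w shift (splitAt m)) ⟩
  w₀ +ℕ weight (w ∘ shift) (tabulate (splitAt m))                        ≡⟨ cong (w₀ +ℕ_) (weight-tabulate-splitAt m (w ∘ shift)) ⟩
  w₀ +ℕ (weight (w ∘ inj₁ ∘ suc) (tabulate id) +ℕ right)                 ≡⟨ ℕ.+-assoc w₀ _ right ⟨
  w₀ +ℕ weight (w ∘ inj₁ ∘ suc) (tabulate id) +ℕ right                   ≡⟨ cong (λ s → w₀ +ℕ s +ℕ right) (push (w ∘ inj₁) suc id) ⟨
  weight (w ∘ inj₁) (tabulate id) +ℕ right                               ∎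
  where
  open ≡-Reasoning
  w₀ = w (inj₁ zero)
  right = weight (w ∘ inj₂) (tabulate id)
  shift : Fin m ⊎ Fin k → Fin (suc m) ⊎ Fin k
  shift = Sum.map suc id
  push : {B C : Set} {l : ℕ} (w : C → ℕ) (h : B → C) (f : Fin l → B) →
         weight w (tabulate (h ∘ f)) ≡ weight (w ∘ h) (tabulate f)
  push w h f = cong Vec.sum (trans (sym (Vec.tabulate-∘ w (h ∘ f))) (Vec.tabulate-∘ (w ∘ h) f))

weight-𝟙-zero : (_≟_ : (x y : A) → Dec (x ≡ y)) (y : A) (h : Fin m → A) → (∀ i → h i ≢ y) →
                weight (λ x → 𝟙 (x ≟ y)) (tabulate h) ≡ 0
weight-𝟙-zero {m = zero}  _≟_ y h h≢y = refl
weight-𝟙-zero {m = suc m} _≟_ y h h≢y with h zero ≟ y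
... | yes h₀≡y = contradiction h₀≡y (h≢y zero)
... | no  _    = weight-𝟙-zero _≟_ y (h ∘ suc) (h≢y ∘ suc)

-- Once `y` is hit, injectivity excludes every later index. Applied to the enumeration of the
-- vertices, this says that no vertex is repeated.
weight-𝟙-injective : (_≟_ : (x y : A) → Dec (x ≡ y)) (y : A) (h : Fin m → A) → (∀ {i j} → h i ≡ h j → i ≡ j) →
                     weight (λ x → 𝟙 (x ≟ y)) (tabulate h) ≤ℕ 1
weight-𝟙-injective {m = zero}  _≟_ y h inj = z≤n
weight-𝟙-injective {m = suc m} _≟_ y h inj with h zero ≟ y
... | no  _    = weight-𝟙-injective _≟_ y (h ∘ suc) (Fin.suc-injective ∘ inj)
... | yes h₀≡y = s≤s (ℕ.≤-reflexive (weight-𝟙-zero _≟_ y (h ∘ suc)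
                   (λ i hᵢ≡y → Fin.0≢1+n (inj (trans h₀≡y (sym hᵢ≡y))))))

-- Sums over all orderings.

total : (Vec A m → ℕ) → Vec A m → ℕ
total f xs = sum (map f (orderings xs))

sum-map-concatMap : {B C : Set} (f : B → ℕ) (g : C → List B) (xs : List C) →
                    sum (map f (concatMap g xs)) ≡ sum (map (λ x → sum (map f (g x))) xs)
sum-map-concatMap f g []       = refl
sum-map-concatMap f g (x ∷ xs) = begin
  sum (map f (g x List.++ concatMap g xs))                 ≡⟨ cong sum (map-++ f (g x) _) ⟩
  sum (map f (g x) List.++ map f (concatMap g xs))         ≡⟨ sum-++ (map f (g x)) _ ⟩
  sum (map f (g x)) +ℕ sum (map f (concatMap g xs))        ≡⟨ cong (sum (map f (g x)) +ℕ_) (sum-map-concatMap f g xs) ⟩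
  sum (map f (g x)) +ℕ sum (map (λ x → sum (map f (g x))) xs) ∎
  where
  open ≡-Reasoning

total-suc : (f : Vec A (suc m) → ℕ) (xs : Vec A (suc m)) →
            total f xs ≡ sum (List.tabulate λ i → total (f ∘ (lookup xs i ∷_)) (removeAt xs i))
total-suc {m = m} f xs = begin
  total f xs                                      ≡⟨ sum-map-concatMap f (orderingsFrom xs) (allFin (suc m)) ⟩
  sum (map startingAt (allFin (suc m)))           ≡⟨ cong sum (map-tabulate id startingAt) ⟩
  sum (List.tabulate startingAt)                  ≡⟨ cong sum (tabulate-cong λ i → cong sum
                                                       (sym (map-∘ {g = f} {f = lookup xs i ∷_} (orderings (removeAt xs i))))) ⟩
  sum (List.tabulate λ i → total (f ∘ (lookup xs i ∷_)) (removeAt xs i)) ∎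
  where
  open ≡-Reasoning
  startingAt : Fin (suc m) → ℕ
  startingAt i = sum (map f (orderingsFrom xs i))

-- The law of total expectation with denominators cleared: if the mean of `d * f` is at most `w x`
-- once the first entry is `x`, the overall mean is at most the average of `w`. The factor `d` makes
-- room for fractional bounds.
total-weighted : (d : ℕ) (w : A → ℕ) (f : Vec A (suc m) → ℕ) (xs : Vec A (suc m)) →
  (∀ i → d *ℕ total (f ∘ (lookup xs i ∷_)) (removeAt xs i) ≤ℕ w (lookup xs i) *ℕ m !) →
  d *ℕ total f xs ≤ℕ weight w xs *ℕ m !
total-weighted {A = A} {m = m} d w f xs bound =
  subst (λ s → d *ℕ s ≤ℕ weight w xs *ℕ m !) (sym (total-suc f xs)) (sum-bound _ xs bound)
  where
  sum-bound : ∀ {k} (t : Fin k → ℕ) (ys : Vec A k) → (∀ i → d *ℕ t i ≤ℕ w (lookup ys i) *ℕ m !) →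
              d *ℕ sum (List.tabulate t) ≤ℕ weight w ys *ℕ m !
  sum-bound t []       b = ℕ.≤-reflexive (ℕ.*-zeroʳ d)
  sum-bound t (y ∷ ys) b = begin
    d *ℕ (t zero +ℕ sum (List.tabulate (t ∘ suc)))          ≡⟨ ℕ.*-distribˡ-+ d (t zero) _ ⟩
    d *ℕ t zero +ℕ d *ℕ sum (List.tabulate (t ∘ suc))       ≤⟨ ℕ.+-mono-≤ (b zero) (sum-bound (t ∘ suc) ys (b ∘ suc)) ⟩
    w y *ℕ m ! +ℕ weight w ys *ℕ m !                         ≡⟨ ℕ.*-distribʳ-+ (m !) (w y) _ ⟨
    weight w (y ∷ ys) *ℕ m !                                 ∎
    where open ℕ.≤-Reasoning

total-≤ : (c : ℕ) (f : Vec A m → ℕ) (xs : Vec A m) → (∀ ys → f ys ≤ℕ c) → total f xs ≤ℕ c *ℕ m !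
total-≤ {m = m} c f xs f≤c = subst (λ l → total f xs ≤ℕ c *ℕ l) (length-orderings xs) (bound (orderings xs))
  where
  bound : ∀ yss → sum (map f yss) ≤ℕ c *ℕ length yss
  bound []         = z≤n
  bound (ys ∷ yss) = subst (sum (map f (ys ∷ yss)) ≤ℕ_) (sym (ℕ.*-suc c _)) (ℕ.+-mono-≤ (f≤c ys) (bound yss))

total-mono : (f g : Vec A m → ℕ) (xs : Vec A m) → (∀ ys → f ys ≤ℕ g ys) → total f xs ≤ℕ total g xs
total-mono f g xs f≤g = bound (orderings xs)
  where
  bound : ∀ yss → sum (map f yss) ≤ℕ sum (map g yss)
  bound []         = z≤n
  bound (ys ∷ yss) = ℕ.+-mono-≤ (f≤g ys) (bound yss)

-- The hypothesis bounds `s / F` by `5/2 + 15/N`, which can only grow when `N` is replaced by the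
-- smaller `n`. The case analysis supplies `N = 2n - 2`.
mean-≤-shrink : ∀ {n N s F} → n ≤ℕ N → 2 *ℕ N *ℕ s ≤ℕ (5 *ℕ N +ℕ 14 +ℕ 16) *ℕ F → 2 *ℕ n *ℕ s ≤ℕ (5 *ℕ n +ℕ 30) *ℕ F
mean-≤-shrink {N = zero}          z≤n _     = z≤n
mean-≤-shrink {n} {N@(suc _)} {s} {F} n≤N bound = ℕ.*-cancelˡ-≤ N (begin
  N *ℕ (2 *ℕ n *ℕ s)                         ≡⟨ swapFactors N n s ⟩
  n *ℕ (2 *ℕ N *ℕ s)                         ≤⟨ ℕ.*-monoʳ-≤ n bound ⟩
  n *ℕ ((5 *ℕ N +ℕ 14 +ℕ 16) *ℕ F)           ≡⟨ expand n N F ⟩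
  5 *ℕ (n *ℕ N *ℕ F) +ℕ 30 *ℕ (n *ℕ F)       ≤⟨ ℕ.+-monoʳ-≤ (5 *ℕ (n *ℕ N *ℕ F)) (ℕ.*-monoʳ-≤ 30 (ℕ.*-monoˡ-≤ F n≤N)) ⟩
  5 *ℕ (n *ℕ N *ℕ F) +ℕ 30 *ℕ (N *ℕ F)       ≡⟨ collect n N F ⟩
  N *ℕ ((5 *ℕ n +ℕ 30) *ℕ F)                 ∎)
  where
  open ℕ.≤-Reasoning
  swapFactors : ∀ N n s → N *ℕ (2 *ℕ n *ℕ s) ≡ n *ℕ (2 *ℕ N *ℕ s)
  swapFactors = solve-∀
  expand : ∀ n N F → n *ℕ ((5 *ℕ N +ℕ 14 +ℕ 16) *ℕ F) ≡ 5 *ℕ (n *ℕ N *ℕ F) +ℕ 30 *ℕ (n *ℕ F)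
  expand = solve-∀
  collect : ∀ n N F → 5 *ℕ (n *ℕ N *ℕ F) +ℕ 30 *ℕ (N *ℕ F) ≡ N *ℕ ((5 *ℕ n +ℕ 30) *ℕ F)
  collect = solve-∀

-- States of a run on the crown and their conditional means.

module Crown (n : ℕ) where

  V : Set
  V = Fin n ⊎ Fin n

  _≟V_ : (x y : V) → Dec (x ≡ y)
  _≟V_ = ≡-dec Fin._≟_ Fin._≟_

  Colouring : Set
  Colouring = List (V × ℕ)

  neighbours : V → Colouring → Colouring
  neighbours x = filter (λ e → crownAdj? n x (proj₁ e))

  newColour : Colouring → V → ℕ
  newColour P x = leastAbsentColour (map proj₂ (neighbours x P))

  extend : Colouring → V → Colouring
  extend P x = (x , newColour P x) ∷ P

  used : Colouring → List V → ℕ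
  used P vs = distinct (map proj₂ (firstFitFrom (crown n) P vs))

  S : Colouring → Vec V m → ℕ
  S P R = total (used P ∘ toList) R

  weightL : (V → ℕ) → Colouring → ℕ
  weightL w P = sum (map (w ∘ proj₁) P)

  vertices : Vec V (n +ℕ n)
  vertices = FiniteSimpleGraph.vertices (crown n)

  -- P and R together list every vertex exactly once, tested against all weight functions.
  record Partition {m} (P : Colouring) (R : Vec V m) : Set where
    constructor partition
    field weigh : ∀ w → weightL w P +ℕ weight w R ≡ weight w vertices

  Fresh : Colouring → V → Set
  Fresh P x = All (λ e → x ≢ proj₁ e) P

  -- `S P R / m!` is the mean final number of colours from the state `P` when the vertices of `R`
  -- arrive in random order; it is bounded by `v / d`.
  record Bounded {m} (d v : ℕ) (P : Colouring) (R : Vec V m) : Set where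
    constructor bounded
    field bound : d *ℕ S P R ≤ℕ v *ℕ m !

  open Partition
  open Bounded

  partition-extend : ∀ {P} {R : Vec V (suc m)} → Partition P R → ∀ i c →
                     Partition ((lookup R i , c) ∷ P) (removeAt R i)
  partition-extend {P = P} {R} part i c = partition λ w →
    trans (solve (w (lookup R i)) (weightL w P) _)
      (trans (cong (weightL w P +ℕ_) (sym (weight-removeAt w R i))) (weigh part w))
    where
    solve : ∀ a b c → a +ℕ b +ℕ c ≡ b +ℕ (a +ℕ c)
    solve = solve-∀

  partition-↭ : ∀ {P Q} {R : Vec V m} → P ↭ Q → Partition P R → Partition Q R
  partition-↭ {R = R} P↭Q part = partition λ w →
    trans (cong (_+ℕ weight w R) (sum-↭ (Perm.map⁺ (w ∘ proj₁) (↭-sym P↭Q)))) (weigh part w)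

  partition-size : ∀ {P} {R : Vec V m} → Partition P R → length P +ℕ m ≡ n +ℕ n
  partition-size {m = m} {P} {R} part = begin
    length P +ℕ m                                   ≡⟨ cong₂ _+ℕ_ (count P) (sym (trans (weight-const 1 R) (ℕ.*-identityʳ m))) ⟩
    weightL (const 1) P +ℕ weight (const 1) R        ≡⟨ weigh part (const 1) ⟩
    weight (const 1) vertices                       ≡⟨ weight-const 1 vertices ⟩
    (n +ℕ n) *ℕ 1                                   ≡⟨ ℕ.*-identityʳ _ ⟩
    n +ℕ n                                          ∎
    where
    open ≡-Reasoning
    count : ∀ P → length P ≡ weightL (const 1) P
    count []      = refl
    count (_ ∷ P) = cong suc (count P)

  partition-weight : ∀ {P} {R : Vec V m} → Partition P R → ∀ w → weight w R ≤ℕ weight w vertices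
  partition-weight {P = P} part w = ℕ.m+n≤o⇒n≤o (weightL w P) (ℕ.≤-reflexive (weigh part w))

  multiplicity-≤1 : ∀ x → weight (λ y → 𝟙 (y ≟V x)) vertices ≤ℕ 1
  multiplicity-≤1 x = weight-𝟙-injective _≟V_ x (splitAt n) λ {i} {j} eq →
    trans (sym (Fin.join-splitAt n n i)) (trans (cong (join n n) eq) (Fin.join-splitAt n n j))

  -- Weigh with the indicator of the next vertex: were it already coloured, `P` and `R` would both
  -- contribute, while the enumeration of all vertices has weight at most one.
  partition-fresh : ∀ {P} {R : Vec V (suc m)} → Partition P R → ∀ i → Fresh P (lookup R i)
  partition-fresh {P = P} {R} part i = All.tabulate λ {e} e∈P x≡y → contradiction
    (ℕ.≤-trans (ℕ.+-mono-≤ (inList e∈P x≡y) inVec) (ℕ.≤-trans (ℕ.≤-reflexive (weigh part w)) (multiplicity-≤1 x)))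
    λ { (s≤s ()) }
    where
    x = lookup R i
    w : V → ℕ
    w y = 𝟙 (y ≟V x)
    w-x : ∀ {y} → x ≡ y → 1 ≤ℕ w y
    w-x refl with x ≟V x
    ... | yes _   = s≤s z≤n
    ... | no  x≢x = contradiction refl x≢x
    inList : ∀ {e P} → e ∈ P → x ≡ proj₁ e → 1 ≤ℕ weightL w P
    inList (here refl)            x≡y = ℕ.≤-trans (w-x x≡y) (ℕ.m≤m+n _ _)
    inList (there {x = e'} e∈P)   x≡y = ℕ.≤-trans (inList e∈P x≡y) (ℕ.m≤n+m _ (w (proj₁ e')))
    inVec : 1 ≤ℕ weight w R
    inVec = subst (1 ≤ℕ_) (sym (weight-removeAt w R i)) (ℕ.≤-trans (w-x refl) (ℕ.m≤m+n _ _))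

  -- Reordering a state, conditioning on the next vertex, and rare exceptions.

  newColour-↭ : ∀ {P Q} → P ↭ Q → ∀ x → newColour P x ≡ newColour Q x
  newColour-↭ P↭Q x = leastAbsentColour-↭ (Perm.map⁺ proj₂ (Perm.filter-↭ _ P↭Q))

  -- Permuting the state affects neither the next colours nor the final set of colours, so one shape
  -- serves for every order in which it can arise.
  used-↭ : ∀ {P Q} → P ↭ Q → ∀ vs → used P vs ≤ℕ used Q vs
  used-↭ P↭Q []       = distinct-⊆ (Perm.∈-resp-↭ (Perm.map⁺ proj₂ P↭Q))
  used-↭ {P} {Q} P↭Q (v ∷ vs) = used-↭ {extend P v} {extend Q v}
    (subst (λ c → extend P v ↭ (v , c) ∷ Q) (newColour-↭ P↭Q v) (prep _ P↭Q)) vs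

  bounded-↭ : ∀ {P Q d v} {R : Vec V m} → P ↭ Q → Bounded d v Q R → Bounded d v P R
  bounded-↭ {d = d} {R = R} P↭Q b = bounded (ℕ.≤-trans (ℕ.*-monoʳ-≤ d (total-mono _ _ R (used-↭ P↭Q ∘ toList))) (bound b))

  bounded-scale : ∀ {P v v'} {R : Vec V m} d → d *ℕ v ≤ℕ v' → Bounded 1 v P R → Bounded d v' P R
  bounded-scale {m = m} {P} {v} {v'} {R} d dv≤v' b = bounded (begin
    d *ℕ S P R            ≡⟨ cong (d *ℕ_) (ℕ.*-identityˡ _) ⟨
    d *ℕ (1 *ℕ S P R)     ≤⟨ ℕ.*-monoʳ-≤ d (bound b) ⟩
    d *ℕ (v *ℕ m !)       ≡⟨ ℕ.*-assoc d v _ ⟨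
    d *ℕ v *ℕ m !         ≤⟨ ℕ.*-monoˡ-≤ (m !) dv≤v' ⟩
    v' *ℕ m !             ∎)
    where open ℕ.≤-Reasoning

  bounded-weaken : ∀ {P d v v'} {R : Vec V m} → v ≤ℕ v' → Bounded d v P R → Bounded d v' P R
  bounded-weaken {m = m} v≤v' b = bounded (ℕ.≤-trans (bound b) (ℕ.*-monoˡ-≤ (m !) v≤v'))

  bounded-colour : ∀ {P x c d v} {R : Vec V m} → newColour P x ≡ c →
                   Bounded d v ((x , c) ∷ P) R → Bounded d v (extend P x) R
  bounded-colour {P = P} {x} {d = d} {v} {R} eq = subst (λ c → Bounded d v ((x , c) ∷ P) R) (sym eq)

  -- `w x` bounds `d` times the conditional mean after `x`. The new partition is offered for every
  -- colour `c`, since partitions ignore colours; the caller takes the colour it has computed.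
  bounded-step : ∀ {P} {R : Vec V (suc m)} → Partition P R → ∀ d w →
    (∀ x {R' : Vec V m} → Fresh P x → (∀ c → Partition ((x , c) ∷ P) R') → Bounded d (w x) (extend P x) R') →
    d *ℕ S P R ≤ℕ weight w R *ℕ m !
  bounded-step {P = P} {R} part d w next = total-weighted d w (used P ∘ toList) R
    (λ i → bound (next (lookup R i) (partition-fresh part i) (partition-extend part i)))

  bounded-uniform : ∀ {P} {R : Vec V (suc m)} → Partition P R → ∀ d c →
    (∀ x {R' : Vec V m} → Fresh P x → (∀ c → Partition ((x , c) ∷ P) R') → Bounded d c (extend P x) R') →
    Bounded d c P R
  bounded-uniform {m = m} {P} {R} part d c next = bounded (ℕ.≤-trans (bounded-step part d (const c) next)
    (ℕ.≤-reflexive (trans (cong (_*ℕ m !) (weight-const c R)) (solve (suc m) c (m !)))))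
    where
    solve : ∀ a b c → a *ℕ b *ℕ c ≡ b *ℕ (a *ℕ c)
    solve = solve-∀

  weight-mate : ∀ {P} {R : Vec V m} → Partition P R → ∀ y → weight (λ x → 𝟙 (x ≟V y)) R ≤ℕ 1
  weight-mate part y = ℕ.≤-trans (partition-weight part _) (multiplicity-≤1 y)

  -- The vertex `y` occurs at most once among the `suc m` remaining ones, so it comes next with
  -- probability at most `1 / suc m`, and its cost `b` adds at most `e` to the mean.
  bounded-exception : ∀ {P} {R : Vec V (suc m)} → Partition P R → ∀ d c b e y → b ≤ℕ e *ℕ suc m →
    (∀ x {R' : Vec V m} → x ≢ y → Fresh P x → (∀ c → Partition ((x , c) ∷ P) R') → Bounded d c (extend P x) R') →
    ({R' : Vec V m} → (∀ c → Partition ((y , c) ∷ P) R') → Bounded d b (extend P y) R') →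
    Bounded d (c +ℕ e) P R
  bounded-exception {m = m} {P} {R} part d c b e y b≤em normal exceptional = bounded (begin
    d *ℕ S P R                                      ≤⟨ bounded-step part d w next ⟩
    weight w R *ℕ m !                               ≡⟨ cong (_*ℕ m !) (trans (weight-+ (const c) (λ x → b *ℕ 𝟙 (x ≟V y)) R)
                                                          (cong₂ _+ℕ_ (weight-const c R) (weight-* b _ R))) ⟩
    (suc m *ℕ c +ℕ b *ℕ weight (λ x → 𝟙 (x ≟V y)) R) *ℕ m !
                                                    ≤⟨ ℕ.*-monoˡ-≤ (m !) (ℕ.+-monoʳ-≤ (suc m *ℕ c) (ℕ.*-monoʳ-≤ b (weight-mate {R = R} part y))) ⟩
    (suc m *ℕ c +ℕ b *ℕ 1) *ℕ m !                   ≤⟨ ℕ.*-monoˡ-≤ (m !) (ℕ.+-monoʳ-≤ (suc m *ℕ c) (ℕ.≤-trans (ℕ.≤-reflexive (ℕ.*-identityʳ b)) b≤em)) ⟩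
    (suc m *ℕ c +ℕ e *ℕ suc m) *ℕ m !               ≡⟨ solve (suc m) c e (m !) ⟩
    (c +ℕ e) *ℕ (suc m) !                           ∎)
    where
    open ℕ.≤-Reasoning
    w : V → ℕ
    -- `y` is charged `c + b`, more than the `b` it needs, so that the weight is a constant plus a
    -- multiple of an indicator.
    w x = c +ℕ b *ℕ 𝟙 (x ≟V y)
    next : ∀ x {R' : Vec V m} → Fresh P x → (∀ c → Partition ((x , c) ∷ P) R') → Bounded d (w x) (extend P x) R'
    next x fresh part' with x ≟V y
    ... | no  x≢y  = bounded-weaken (ℕ.m≤m+n c _) (normal x x≢y fresh part')
    ... | yes refl = bounded-weaken (ℕ.≤-trans (ℕ.≤-reflexive (sym (ℕ.*-identityʳ b))) (ℕ.m≤n+m _ c)) (exceptional part')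
    solve : ∀ a b c d → (a *ℕ b +ℕ c *ℕ a) *ℕ d ≡ (b +ℕ c) *ℕ (a *ℕ d)
    solve = solve-∀

  used-≤ : ∀ P vs → used P vs ≤ℕ length P +ℕ length vs
  used-≤ P []       = ℕ.≤-trans (length-deduplicate ℕ._≟_ (map proj₂ P))
    (ℕ.≤-reflexive (trans (length-map proj₂ P) (sym (ℕ.+-identityʳ _))))
  used-≤ P (v ∷ vs) = ℕ.≤-trans (used-≤ (extend P v) vs) (ℕ.≤-reflexive (sym (ℕ.+-suc (length P) _)))

  bounded-trivial : ∀ {P} {R : Vec V m} → Partition P R → Bounded 1 (n +ℕ n) P R
  bounded-trivial {m = m} {P} {R} part = bounded (subst (_≤ℕ (n +ℕ n) *ℕ m !) (sym (ℕ.*-identityˡ _))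
    (total-≤ (n +ℕ n) _ R λ ys → ℕ.≤-trans (used-≤ P (toList ys))
      (ℕ.≤-reflexive (trans (cong (length P +ℕ_) (Vec.length-toList ys)) (partition-size part)))))

  -- Adjacency in the crown, up to exchanging the two sides.

  data Sides : (f g : Fin n → V) → Set where
    uv : Sides inj₁ inj₂
    vu : Sides inj₂ inj₁

  flip : ∀ {f g} → Sides f g → Sides g f
  flip uv = vu
  flip vu = uv

  data View (f g : Fin n → V) : V → Set where
    own : ∀ k → View f g (f k)
    opp : ∀ k → View f g (g k)

  view : ∀ {f g} → Sides f g → ∀ x → View f g x
  view uv (inj₁ k) = own k
  view uv (inj₂ k) = opp k
  view vu (inj₁ k) = opp k
  view vu (inj₂ k) = own k

  adjacent : ∀ {f g} → Sides f g → ∀ {i j} → i ≢ j → CrownAdj n (f i) (g j)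
  adjacent uv i≢j = i≢j
  adjacent vu i≢j = i≢j

  mates : ∀ {f g} → Sides f g → ∀ i → ¬ CrownAdj n (f i) (g i)
  mates uv i adj = adj refl
  mates vu i adj = adj refl

  sameSide : ∀ {f g} → Sides f g → ∀ i j → ¬ CrownAdj n (f i) (f j)
  sameSide uv i j ()
  sameSide vu i j ()

  injective : ∀ {f g} → Sides f g → ∀ {i j} → f i ≡ f j → i ≡ j
  injective uv = inj₁-injective
  injective vu = inj₂-injective

  -- A certificate that decides adjacency entry by entry. Its index is an explicit list of colours,
  -- so on a concrete shape the least absent colour evaluates to a numeral.
  data NeighbourColours (x : V) : Colouring → List ℕ → Set where
    []   : NeighbourColours x [] []
    keep : ∀ {y c P cs} → CrownAdj n x y → NeighbourColours x P cs → NeighbourColours x ((y , c) ∷ P) (c ∷ cs)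
    skip : ∀ {y c P cs} → ¬ CrownAdj n x y → NeighbourColours x P cs → NeighbourColours x ((y , c) ∷ P) cs

  neighbourColours-map : ∀ {x P cs} → NeighbourColours x P cs → map proj₂ (neighbours x P) ≡ cs
  neighbourColours-map []             = refl
  neighbourColours-map {x} (keep adj ns)  =
    trans (cong (map proj₂) (filter-accept (λ e → crownAdj? n x (proj₁ e)) adj)) (cong (_ ∷_) (neighbourColours-map ns))
  neighbourColours-map {x} (skip ¬adj ns) =
    trans (cong (map proj₂) (filter-reject (λ e → crownAdj? n x (proj₁ e)) ¬adj)) (neighbourColours-map ns)

  colourFrom : ∀ {x P cs} → NeighbourColours x P cs → newColour P x ≡ leastAbsentColour cs
  colourFrom ns = cong leastAbsentColour (neighbourColours-map ns)

  -- Decided states and the bound they give.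

  data Fits (f g : Fin n → V) (c : ℕ) : V × ℕ → Set where
    own : ∀ {k d} → 1 ≤ℕ d → d ≤ℕ c → Fits f g c (f k , d)
    opp : ∀ {k d} → 1 ≤ℕ d → d ≤ℕ suc c → d ≢ c → Fits f g c (g k , d)

  -- Once two vertices of a side have colour c, no vertex of the other side can receive c, so
  -- everything to come on the first side has colour at most c, and on the other at most suc c.
  record Decided (f g : Fin n → V) (c : ℕ) (P : Colouring) : Set where
    constructor decided
    field
      {i j} : Fin n
      i≢j   : i ≢ j
      i∈P   : (f i , c) ∈ P
      j∈P   : (f j , c) ∈ P
      fits  : All (Fits f g c) P

  fits-range : ∀ {f g c e} → Fits f g c e → 1 ≤ℕ proj₂ e × proj₂ e ≤ℕ suc c
  fits-range (own 1≤d d≤c)   = 1≤d , ℕ.m≤n⇒m≤1+n d≤c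
  fits-range (opp 1≤d d≤c _) = 1≤d , d≤c

  -- Colour `c` is always free for a vertex on the side of `f`, as its neighbours avoid `c`; `suc c`
  -- is always free on the side of `g`, as the neighbours there stay at or below `c`. FirstFit never
  -- goes higher than a free colour.
  decided-extend : ∀ {f g c P} → Sides f g → Decided f g c P → ∀ x → Decided f g c (extend P x)
  decided-extend {f} {g} {c} {P} sides (decided {i} {j} i≢j i∈P j∈P fits) x =
    decided i≢j (there i∈P) (there j∈P) (fitsNew (view sides x) ∷ fits)
    where
    1≤c = proj₁ (fits-range (All.lookup fits i∈P))

    seenBy : V → List ℕ
    seenBy y = map proj₂ (neighbours y P)

    positiveNew : ∀ y → 1 ≤ℕ newColour P y
    positiveNew y = LeastAbsent.positive (leastAbsent (seenBy y))

    own-avoids : ∀ {k y d} → Fits f g c (y , d) → CrownAdj n (f k) y → d ≢ c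
    own-avoids (own _ _)     adj = contradiction adj (sameSide sides _ _)
    own-avoids (opp _ _ d≢c) adj = d≢c

    opp-avoids : ∀ {k y d} → Fits f g c (y , d) → CrownAdj n (g k) y → d ≢ suc c
    opp-avoids (own _ d≤c)   adj refl = ℕ.1+n≰n d≤c
    opp-avoids (opp _ _ _)   adj = contradiction adj (sameSide (flip sides) _ _)

    absentFrom : ∀ {d} y → (∀ {z d'} → Fits f g c (z , d') → CrownAdj n y z → d' ≢ d) →
                 d ∉ seenBy y
    absentFrom y avoids d∈ with ∈-map∘filter⁻ proj₂ (λ e → crownAdj? n y (proj₁ e)) d∈
    ... | (z , d') , e∈P , refl , adj = avoids (All.lookup fits e∈P) adj refl

    present : ∀ {y z d} → (z , d) ∈ P → CrownAdj n y z → newColour P y ≢ d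
    present {y} e∈P adj refl = LeastAbsent.absent (leastAbsent (seenBy y))
      (∈-map∘filter⁺ proj₂ (λ e → crownAdj? n y (proj₁ e)) (_ , e∈P , refl , adj))

    fitsNew : ∀ {x} → View f g x → Fits f g c (x , newColour P x)
    fitsNew (own k) = own (positiveNew (f k))
      (leastAbsentColour-≤ (seenBy (f k)) 1≤c (absentFrom (f k) own-avoids))
    fitsNew (opp k) = opp (positiveNew (g k))
      (leastAbsentColour-≤ (seenBy (g k)) (s≤s z≤n) (absentFrom (g k) opp-avoids)) notC
      where
      notC : newColour P (g k) ≢ c
      -- `g k` misses only its mate `f k`, so it sees at least one of the two distinct vertices
      -- `f i` and `f j` coloured `c`.
      notC with k Fin.≟ i
      ... | no  k≢i  = present i∈P (adjacent (flip sides) k≢i)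
      ... | yes refl = present j∈P (adjacent (flip sides) i≢j)

  used-decided : ∀ {f g c P} → Sides f g → Decided f g c P → ∀ vs → used P vs ≤ℕ suc c
  used-decided {c = c} {P} sides dec [] = distinct-≤ (suc c) range
    where
    range : ∀ {d} → d ∈ map proj₂ P → 1 ≤ℕ d × d ≤ℕ suc c
    range d∈ with ∈-map⁻ proj₂ d∈
    ... | e , e∈P , refl = fits-range (All.lookup (Decided.fits dec) e∈P)
  used-decided sides dec (v ∷ vs) = used-decided sides (decided-extend sides dec v) vs

  bounded-decided : ∀ {f g c v P} {R : Vec V m} → Sides f g → suc c ≤ℕ v → Decided f g c P → Bounded 1 v P R
  bounded-decided {m = m} {v = v} {R = R} sides c<v dec = bounded (subst (_≤ℕ v *ℕ m !) (sym (ℕ.*-identityˡ _))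
    (total-≤ v _ R λ ys → ℕ.≤-trans (used-decided sides dec (toList ys)) c<v))

  ownFits : ∀ {f g c k d} {_ : True (1 ℕ.≤? d)} {_ : True (d ℕ.≤? c)} → Fits f g c (f k , d)
  ownFits {_} {_} {_} {_} {_} {1≤d} {d≤c} = own (toWitness 1≤d) (toWitness d≤c)

  oppFits : ∀ {f g c k d} {_ : True (1 ℕ.≤? d)} {_ : True (d ℕ.≤? suc c)} {_ : False (d ℕ.≟ c)} →
            Fits f g c (g k , d)
  oppFits {_} {_} {_} {_} {_} {1≤d} {d≤1+c} {d≢c} = opp (toWitness 1≤d) (toWitness d≤1+c) (toWitnessFalse d≢c)

  -- The undecided shapes, treated from the last to the first.

  matched : (f g : Fin n → V) → Fin n → Colouring
  matched f g i = (f i , 1) ∷ (g i , 1) ∷ []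

  module _ {f g : Fin n → V} (sides : Sides f g) where

    private
      twice≤ : n ≤ℕ m → n +ℕ n ≤ℕ 2 *ℕ m
      twice≤ {m} n≤m = ℕ.+-mono-≤ n≤m (ℕ.≤-trans n≤m (ℕ.≤-reflexive (sym (ℕ.+-identityʳ m))))

    -- Meeting `g k`, the mate of `f k`, has probability at most `1 / suc m`, so the trivial bound
    -- `2n` adds at most 2. Every other vertex decides: a new `f j` gets 2, leaving at most 3
    -- colours, and a new `g j` gets 3, leaving at most 4. Hence `6 = 4 + 2`.
    bounded-matched₂ : ∀ {i k l} {R : Vec V (suc m)} → n ≤ℕ suc m → k ≢ i → l ≢ i → l ≢ k →
      Partition ((g l , 3) ∷ (f k , 2) ∷ matched f g i) R → Bounded 1 6 ((g l , 3) ∷ (f k , 2) ∷ matched f g i) R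
    bounded-matched₂ {m = m} {i = i} {k} {l} n≤m k≢i l≢i l≢k part =
      bounded-exception part 1 4 (n +ℕ n) 2 (g k) (twice≤ n≤m) normal (λ part' → bounded-trivial (part' _))
      where
      P = (g l , 3) ∷ (f k , 2) ∷ matched f g i
      normal : ∀ x {R' : Vec V m} → x ≢ g k → Fresh P x → (∀ c → Partition ((x , c) ∷ P) R') → Bounded 1 4 (extend P x) R'
      normal x x≢gk fresh part' with view sides x
      normal _ _ (_ ∷ ≢fk ∷ ≢fi ∷ _) _ | own j = bounded-colour colour (bounded-decided sides (toWitness {a? = 3 ℕ.≤? 4} _)
        (decided (≢fk ∘ cong f) (here refl) (there (there (here refl))) (ownFits ∷ oppFits ∷ ownFits ∷ ownFits ∷ oppFits ∷ [])))
        where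
        colour : newColour P (f j) ≡ 2
        -- `f j` sees the colours 3 and 1, or only 1 if its mate is `g l`; in both cases 2 is the
        -- least absent.
        colour with j Fin.≟ l
        ... | yes refl = colourFrom (skip (mates sides j) (skip (sameSide sides j k) (skip (sameSide sides j i)
                           (keep (adjacent sides (≢fi ∘ cong f)) []))))
        ... | no j≢l   = colourFrom (keep (adjacent sides j≢l) (skip (sameSide sides j k) (skip (sameSide sides j i)
                           (keep (adjacent sides (≢fi ∘ cong f)) []))))
      normal _ ≢gk (≢gl ∷ _ ∷ _ ∷ ≢gi ∷ _) _ | opp j = bounded-colour
        (colourFrom (skip (sameSide (flip sides) j l) (keep (adjacent (flip sides) (≢gk ∘ cong g))
          (keep (adjacent (flip sides) (≢gi ∘ cong g)) (skip (sameSide (flip sides) j i) [])))))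
        (bounded-decided (flip sides) ℕ.≤-refl
          (decided (≢gl ∘ cong g) (here refl) (there (here refl)) (ownFits ∷ ownFits ∷ oppFits ∷ oppFits ∷ ownFits ∷ [])))

    -- Again only the mate `g k` is charged the trivial bound, adding at most 2. A new `f j` gets 2
    -- and decides for at most 3 colours; a new `g l` gets 3 and leads to the last shape, with its
    -- bound 6.
    bounded-matched₁ : ∀ {i k} {R : Vec V (2 +ℕ m)} → n ≤ℕ suc m → k ≢ i →
      Partition ((f k , 2) ∷ matched f g i) R → Bounded 1 8 ((f k , 2) ∷ matched f g i) R
    bounded-matched₁ {m = m} {i = i} {k} n≤m k≢i part =
      bounded-exception part 1 6 (n +ℕ n) 2 (g k) (twice≤ (ℕ.m≤n⇒m≤1+n n≤m)) normal (λ part' → bounded-trivial (part' _))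
      where
      P = (f k , 2) ∷ matched f g i
      normal : ∀ x {R' : Vec V (suc m)} → x ≢ g k → Fresh P x → (∀ c → Partition ((x , c) ∷ P) R') → Bounded 1 6 (extend P x) R'
      normal x x≢gk fresh part' with view sides x
      normal _ _ (≢fk ∷ ≢fi ∷ _) _ | own j = bounded-colour
        (colourFrom (skip (sameSide sides j k) (skip (sameSide sides j i) (keep (adjacent sides (≢fi ∘ cong f)) []))))
        (bounded-decided sides (toWitness {a? = 3 ℕ.≤? 6} _)
          (decided (≢fk ∘ cong f) (here refl) (there (here refl)) (ownFits ∷ ownFits ∷ ownFits ∷ oppFits ∷ [])))
      normal _ ≢gk (_ ∷ _ ∷ ≢gi ∷ _) part' | opp l = bounded-colour
        (colourFrom (keep (adjacent (flip sides) (≢gk ∘ cong g)) (keep (adjacent (flip sides) (≢gi ∘ cong g))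
          (skip (sameSide (flip sides) l i) []))))
        (bounded-matched₂ n≤m k≢i (≢gi ∘ cong g) (≢gk ∘ cong g) (part' 3))

  -- A vertex of either side sees exactly one vertex coloured 1 and gets 2, which gives the shape
  -- just treated or its mirror image.
  bounded-matched₀ : ∀ {f g i} {R : Vec V (3 +ℕ m)} → Sides f g → n ≤ℕ suc m →
    Partition (matched f g i) R → Bounded 1 8 (matched f g i) R
  bounded-matched₀ {m = m} {f} {g} {i} sides n≤m part = bounded-uniform part 1 8 next
    where
    P = matched f g i
    next : ∀ x {R' : Vec V (2 +ℕ m)} → Fresh P x → (∀ c → Partition ((x , c) ∷ P) R') → Bounded 1 8 (extend P x) R'
    next x fresh part' with view sides x
    next _ (≢fi ∷ _) part' | own k = bounded-colour
      (colourFrom (skip (sameSide sides k i) (keep (adjacent sides (≢fi ∘ cong f)) [])))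
      (bounded-matched₁ sides n≤m (≢fi ∘ cong f) (part' 2))
    next _ (_ ∷ ≢gi ∷ _) part' | opp k = bounded-colour
      (colourFrom (keep (adjacent (flip sides) (≢gi ∘ cong g)) (skip (sameSide (flip sides) k i) [])))
      (bounded-↭ reorder (bounded-matched₁ (flip sides) n≤m (≢gi ∘ cong g) (partition-↭ reorder (part' 2))))
      where
      reorder = prep (g k , 2) (swap (f i , 1) (g i , 1) ↭-refl)

  -- The indicator of the side of `g`, used to count the vertices that cost one extra colour.
  opposite : ∀ {f g} → Sides f g → V → ℕ
  opposite uv (inj₁ _) = 0
  opposite uv (inj₂ _) = 1
  opposite vu (inj₁ _) = 1
  opposite vu (inj₂ _) = 0

  opposite-opp : ∀ {f g} (sides : Sides f g) k → opposite sides (g k) ≡ 1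
  opposite-opp uv k = refl
  opposite-opp vu k = refl

  weight-opposite : ∀ {f g} (sides : Sides f g) → weight (opposite sides) vertices ≡ n
  weight-opposite uv = trans (weight-tabulate-splitAt n (opposite uv))
    (trans (cong₂ _+ℕ_ (weight-const 0 (tabulate {n = n} id)) (weight-const 1 (tabulate {n = n} id))) (solve n))
    where
    solve : ∀ n → n *ℕ 0 +ℕ n *ℕ 1 ≡ n
    solve = solve-∀
  weight-opposite vu = trans (weight-tabulate-splitAt n (opposite vu))
    (trans (cong₂ _+ℕ_ (weight-const 1 (tabulate {n = n} id)) (weight-const 0 (tabulate {n = n} id))) (solve n))
    where
    solve : ∀ n → n *ℕ 1 +ℕ n *ℕ 0 ≡ n
    solve = solve-∀

  -- Source of the 5/2: at most n of the 3 + m remaining vertices lie on the side of g and cost 3 rather than 2.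
  bounded-unmatched : ∀ {f g i j} {R : Vec V (3 +ℕ m)} → Sides f g → n ≤ℕ suc m → j ≢ i →
    Partition ((g j , 2) ∷ (f i , 1) ∷ []) R →
    Bounded (2 *ℕ (3 +ℕ m)) (5 *ℕ (3 +ℕ m) +ℕ 14) ((g j , 2) ∷ (f i , 1) ∷ []) R
  bounded-unmatched {m = m} {f} {g} {i} {j} {R} sides n≤m j≢i part = bounded (begin
    2 *ℕ N *ℕ S P R                                              ≡⟨ cong (2 *ℕ N *ℕ_) (ℕ.*-identityˡ (S P R)) ⟨
    2 *ℕ N *ℕ (1 *ℕ S P R)                                       ≤⟨ ℕ.*-monoʳ-≤ (2 *ℕ N) (bounded-step part 1 w next) ⟩
    2 *ℕ N *ℕ (weight w R *ℕ (2 +ℕ m) !)                         ≤⟨ ℕ.*-monoʳ-≤ (2 *ℕ N) (ℕ.*-monoˡ-≤ ((2 +ℕ m) !) weight-w) ⟩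
    2 *ℕ N *ℕ ((N *ℕ 2 +ℕ (n +ℕ 6 *ℕ 1)) *ℕ (2 +ℕ m) !)          ≡⟨ solve N n ((2 +ℕ m) !) ⟩
    -- Two vertices are coloured, so `n + n = 2 + N`; this turns the coefficient 4 into the 5 of the
    -- limit `5/2`.
    (4 *ℕ N +ℕ (n +ℕ n) +ℕ 12) *ℕ N !                            ≡⟨ cong (λ s → (4 *ℕ N +ℕ s +ℕ 12) *ℕ N !) (partition-size part) ⟨
    (4 *ℕ N +ℕ (2 +ℕ N) +ℕ 12) *ℕ N !                            ≡⟨ cong (_*ℕ N !) (solve' N) ⟩
    (5 *ℕ N +ℕ 14) *ℕ N !                                        ∎)
    where
    open ℕ.≤-Reasoning
    N = 3 +ℕ m
    P = (g j , 2) ∷ (f i , 1) ∷ []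

    solve : ∀ N n a → 2 *ℕ N *ℕ ((N *ℕ 2 +ℕ (n +ℕ 6 *ℕ 1)) *ℕ a) ≡ (4 *ℕ N +ℕ (n +ℕ n) +ℕ 12) *ℕ (N *ℕ a)
    solve = solve-∀
    solve' : ∀ N → 4 *ℕ N +ℕ (2 +ℕ N) +ℕ 12 ≡ 5 *ℕ N +ℕ 14
    solve' = solve-∀

    mate : V → ℕ
    mate x = 𝟙 (x ≟V g i)
    w : V → ℕ
    -- A vertex on the side of `f` decides for 2 colours, and one on the side of `g` for 3, unless
    -- it is the mate `g i`. That one leads to a matched shape with bound 8, which the extra 6
    -- covers.
    w x = 2 +ℕ (opposite sides x +ℕ 6 *ℕ mate x)

    weight-w : weight w R ≤ℕ N *ℕ 2 +ℕ (n +ℕ 6 *ℕ 1)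
    weight-w = begin
      weight w R                                                     ≡⟨ weight-+ (const 2) (λ x → opposite sides x +ℕ 6 *ℕ mate x) R ⟩
      weight (const 2) R +ℕ weight (λ x → opposite sides x +ℕ 6 *ℕ mate x) R
                                                                     ≡⟨ cong₂ _+ℕ_ (weight-const 2 R) (trans (weight-+ (opposite sides) (λ x → 6 *ℕ mate x) R)
                                                                          (cong (weight (opposite sides) R +ℕ_) (weight-* 6 mate R))) ⟩
      N *ℕ 2 +ℕ (weight (opposite sides) R +ℕ 6 *ℕ weight mate R)     ≤⟨ ℕ.+-monoʳ-≤ (N *ℕ 2) (ℕ.+-mono-≤
                                                                          (ℕ.≤-trans (partition-weight part (opposite sides)) (ℕ.≤-reflexive (weight-opposite sides)))
                                                                          (ℕ.*-monoʳ-≤ 6 (weight-mate part (g i)))) ⟩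
      N *ℕ 2 +ℕ (n +ℕ 6 *ℕ 1)                                        ∎

    next : ∀ x {R' : Vec V (2 +ℕ m)} → Fresh P x → (∀ c → Partition ((x , c) ∷ P) R') → Bounded 1 (w x) (extend P x) R'
    next x fresh part' with view sides x
    next _ (_ ∷ ≢fi ∷ _) part' | own k = bounded-colour colour (bounded-decided sides (ℕ.m≤m+n 2 _)
      (decided (≢fi ∘ cong f) (here refl) (there (there (here refl))) (ownFits ∷ oppFits ∷ ownFits ∷ [])))
      where
      colour : newColour P (f k) ≡ 1
      -- Whether or not `f k` sees the 2 of `g j`, colour 1 is free for it.
      colour with k Fin.≟ j
      ... | yes refl = colourFrom (skip (mates sides k) (skip (sameSide sides k i) []))
      ... | no k≢j   = colourFrom (keep (adjacent sides k≢j) (skip (sameSide sides k i) []))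
    next _ (≢gj ∷ _) part' | opp k with g k ≟V g i
    ... | no gk≢gi = bounded-colour
      (colourFrom (skip (sameSide (flip sides) k j) (keep (adjacent (flip sides) (gk≢gi ∘ cong g)) [])))
      (bounded-decided (flip sides) (ℕ.+-monoʳ-≤ 2 (ℕ.≤-trans (ℕ.≤-reflexive (sym (opposite-opp sides k))) (ℕ.m≤m+n _ _)))
        (decided (≢gj ∘ cong g) (here refl) (there (here refl)) (ownFits ∷ ownFits ∷ oppFits ∷ [])))
    -- The only coloured vertex across is its mate, so `g i` gets 1. The state is now a matched pair
    -- with the sides exchanged and `g j` as the vertex coloured 2.
    ... | yes gk≡gi with refl ← injective (flip sides) gk≡gi = bounded-colour
      (colourFrom (skip (sameSide (flip sides) k j) (skip (mates (flip sides) k) [])))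
      (bounded-weaken (ℕ.+-monoʳ-≤ 2 (ℕ.m≤n+m 6 _))
        (bounded-↭ reorder (bounded-matched₁ (flip sides) n≤m j≢i (partition-↭ reorder (part' 1)))))
      where
      reorder = swap (g k , 1) (g j , 2) ↭-refl

  -- With `N = 3 + m`, the mate `g i` comes next with probability at most `1 / (N + 1)`, and the
  -- mean 8 after it adds at most `16 / (2N)`. Otherwise a second `f k` decides for 2 colours, or a
  -- `g k` gives the unmatched pair, whose denominator `2N` is adopted here.
  bounded-single : ∀ {f g i} {R : Vec V (4 +ℕ m)} → Sides f g → n ≤ℕ suc m → Partition ((f i , 1) ∷ []) R →
    Bounded (2 *ℕ (3 +ℕ m)) (5 *ℕ (3 +ℕ m) +ℕ 14 +ℕ 16) ((f i , 1) ∷ []) R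
  bounded-single {m = m} {f} {g} {i} sides n≤m part =
    bounded-exception part (2 *ℕ N) (5 *ℕ N +ℕ 14) (16 *ℕ N) 16 (g i) (ℕ.*-monoʳ-≤ 16 (ℕ.n≤1+n N)) normal
      λ part' → bounded-colour (colourFrom (skip (mates (flip sides) i) []))
        (bounded-scale (2 *ℕ N) (ℕ.≤-reflexive (solve N)) (bounded-matched₀ (flip sides) n≤m (part' 1)))
    where
    N = 3 +ℕ m
    P = (f i , 1) ∷ []

    solve : ∀ N → 2 *ℕ N *ℕ 8 ≡ 16 *ℕ N
    solve = solve-∀
    solve' : ∀ N → 2 *ℕ N *ℕ 2 +ℕ (N +ℕ 14) ≡ 5 *ℕ N +ℕ 14
    solve' = solve-∀

    normal : ∀ x {R' : Vec V N} → x ≢ g i → Fresh P x → (∀ c → Partition ((x , c) ∷ P) R') →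
             Bounded (2 *ℕ N) (5 *ℕ N +ℕ 14) (extend P x) R'
    normal x x≢gi fresh part' with view sides x
    normal _ _ (≢fi ∷ _) part' | own k = bounded-scale (2 *ℕ N) (ℕ.m+n≤o⇒m≤o _ (ℕ.≤-reflexive (solve' N)))
      (bounded-colour (colourFrom (skip (sameSide sides k i) [])) (bounded-decided sides ℕ.≤-refl
        (decided (≢fi ∘ cong f) (here refl) (there (here refl)) (ownFits ∷ ownFits ∷ []))))
    normal _ ≢gi _ part' | opp k = bounded-colour (colourFrom (keep (adjacent (flip sides) (≢gi ∘ cong g)) []))
      (bounded-unmatched sides n≤m (≢gi ∘ cong g) (part' 2))

  bounded-start : {R : Vec V (5 +ℕ m)} → n ≤ℕ suc m → Partition [] R →
    Bounded (2 *ℕ (3 +ℕ m)) (5 *ℕ (3 +ℕ m) +ℕ 14 +ℕ 16) [] R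
  bounded-start {m = m} n≤m part = bounded-uniform part _ _ next
    where
    next : ∀ x {R' : Vec V (4 +ℕ m)} → Fresh [] x → (∀ c → Partition ((x , c) ∷ []) R') →
           Bounded (2 *ℕ (3 +ℕ m)) (5 *ℕ (3 +ℕ m) +ℕ 14 +ℕ 16) (extend [] x) R'
    next x@(inj₁ i) _ part' = bounded-colour (colourFrom {x} []) (bounded-single uv n≤m (part' 1))
    next x@(inj₂ i) _ part' = bounded-colour (colourFrom {x} []) (bounded-single vu n≤m (part' 1))

  -- Up to `n = 3` the trivial bound `2n` is at most `5/2 + 15/n`; from 4 on the case analysis
  -- applies.
  total-colours-≤ : 2 *ℕ n *ℕ S [] vertices ≤ℕ (5 *ℕ n +ℕ 30) *ℕ (n +ℕ n) !
  total-colours-≤ = byCases n refl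
    where
    whole : Partition [] vertices
    whole = partition λ w → refl

    small : 2 *ℕ n *ℕ (n +ℕ n) ≤ℕ 5 *ℕ n +ℕ 30 → 2 *ℕ n *ℕ S [] vertices ≤ℕ (5 *ℕ n +ℕ 30) *ℕ (n +ℕ n) !
    small 4n²≤5n+30 = bound (bounded-scale (2 *ℕ n) 4n²≤5n+30 (bounded-trivial whole))

    -- The length `n + n` does not unify with `5 + m`, so it is generalised to `k` and tied back by
    -- an equation.
    fromStart : ∀ {m N k} {R : Vec V k} → N ≡ 3 +ℕ m → k ≡ 5 +ℕ m → n ≤ℕ suc m → Partition [] R →
                Bounded (2 *ℕ N) (5 *ℕ N +ℕ 14 +ℕ 16) [] R
    fromStart refl refl n≤m part = bounded-start n≤m part

    large : ∀ p → n ≡ 4 +ℕ p → 2 *ℕ n *ℕ S [] vertices ≤ℕ (5 *ℕ n +ℕ 30) *ℕ (n +ℕ n) !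
    large p n≡4+p = mean-≤-shrink n≤N (bound (fromStart N≡3+r size n≤1+r whole))
      where
      -- With `n = 4 + p`, `r` is `2n - 5` and `N` is `2n - 2`. The case analysis requires `n` to be
      -- at most `suc r = 2n - 4`, which holds exactly from 4 on.
      r = p +ℕ (3 +ℕ p)
      N = n +ℕ (2 +ℕ p)

      N≡3+r : N ≡ 3 +ℕ r
      N≡3+r rewrite n≡4+p = solve p
        where
        solve : ∀ p → 4 +ℕ p +ℕ (2 +ℕ p) ≡ 3 +ℕ (p +ℕ (3 +ℕ p))
        solve = solve-∀
      size : n +ℕ n ≡ 5 +ℕ r
      size rewrite n≡4+p = solve p
        where
        solve : ∀ p → 4 +ℕ p +ℕ (4 +ℕ p) ≡ 5 +ℕ (p +ℕ (3 +ℕ p))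
        solve = solve-∀
      n≤1+r : n ≤ℕ suc r
      n≤1+r rewrite n≡4+p = s≤s (ℕ.m≤n+m (3 +ℕ p) p)
      n≤N : n ≤ℕ N
      n≤N = ℕ.m≤m+n n _

    check : ∀ k → {_ : True (2 *ℕ k *ℕ (k +ℕ k) ℕ.≤? 5 *ℕ k +ℕ 30)} → n ≡ k →
            2 *ℕ n *ℕ S [] vertices ≤ℕ (5 *ℕ n +ℕ 30) *ℕ (n +ℕ n) !
    check k {holds} n≡k = small (subst (λ k → 2 *ℕ k *ℕ (k +ℕ k) ≤ℕ 5 *ℕ k +ℕ 30) (sym n≡k) (toWitness holds))

    byCases : ∀ k → n ≡ k → 2 *ℕ n *ℕ S [] vertices ≤ℕ (5 *ℕ n +ℕ 30) *ℕ (n +ℕ n) !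
    byCases 0 = check 0
    byCases 1 = check 1
    byCases 2 = check 2
    byCases 3 = check 3
    byCases (suc (suc (suc (suc p)))) = large p

-- From natural numbers to the rational bound.

ratio-≤ : ∀ s l n .{{_ : NonZero l}} .{{_ : NonZero n}} → 2 *ℕ n *ℕ s ≤ℕ (5 *ℕ n +ℕ 30) *ℕ l →
          + s / l ≤ (+ 5 / 2) + (+ 15 / 1) * (+ 1 / n)
ratio-≤ s (suc l) (suc n) bound = ℚ.toℚᵘ-cancel-≤ (begin
  toℚᵘ (+ s / suc l)                                            ≃⟨ ℚ.toℚᵘ-fromℚᵘ (mkℚᵘ (+ s) l) ⟩
  mkℚᵘ (+ s) l                                                    ≤⟨ *≤* integral ⟩
  mkℚᵘ (+ 5) 1 ℚᵘ.+ mkℚᵘ (+ 15) 0 ℚᵘ.* mkℚᵘ (+ 1) n                ≃⟨ ℚᵘ.+-congʳ (mkℚᵘ (+ 5) 1) (ℚᵘ.*-congˡ {mkℚᵘ (+ 15) 0} (ℚ.toℚᵘ-fromℚᵘ (mkℚᵘ (+ 1) n))) ⟨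
  toℚᵘ (+ 5 / 2) ℚᵘ.+ toℚᵘ (+ 15 / 1) ℚᵘ.* toℚᵘ (+ 1 / suc n) ≃⟨ ℚᵘ.+-congʳ (toℚᵘ (+ 5 / 2)) (ℚ.toℚᵘ-homo-* (+ 15 / 1) (+ 1 / suc n)) ⟨
  toℚᵘ (+ 5 / 2) ℚᵘ.+ toℚᵘ ((+ 15 / 1) * (+ 1 / suc n))        ≃⟨ ℚ.toℚᵘ-homo-+ (+ 5 / 2) ((+ 15 / 1) * (+ 1 / suc n)) ⟨
  toℚᵘ ((+ 5 / 2) + (+ 15 / 1) * (+ 1 / suc n))                  ∎)
  where
  open ℚᵘ.≤-Reasoning
  -- Adding unnormalised rationals leaves the denominator `2 * (1 * suc n)`, so the bound is first
  -- brought to this unreduced form.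
  bound' : s *ℕ (2 *ℕ (1 *ℕ suc n)) ≤ℕ (5 *ℕ (1 *ℕ suc n) +ℕ 30) *ℕ suc l
  bound' = ℕ.≤-trans (ℕ.≤-reflexive (solve s (suc n)))
    (ℕ.≤-trans bound (ℕ.≤-reflexive (cong (λ k → (5 *ℕ k +ℕ 30) *ℕ suc l) (sym (ℕ.*-identityˡ (suc n))))))
    where
    solve : ∀ s n → s *ℕ (2 *ℕ (1 *ℕ n)) ≡ 2 *ℕ n *ℕ s
    solve = solve-∀
  integral : + s ℤ.* + (2 *ℕ (1 *ℕ suc n)) ℤ.≤ (+ 5 ℤ.* + (1 *ℕ suc n) ℤ.+ + 15 ℤ.* + 1 ℤ.* + 2) ℤ.* + suc l
  integral = subst (ℤ._≤ _) (ℤ.pos-* s _) (ℤ.+≤+ bound')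

theorem3 : Σ[ K ∈ ℚ ] (0ℚ < K ×
    ((n : ℕ) .{{_ : NonZero n}} → expectedColours (crown n) ≤ (+ 5 / 2) + K * (+ 1 / n)))
-- `K = 15` because `(5n + 30) / (2n) = 5/2 + 15/n`.
theorem3 = + 15 / 1 , ℚ.positive⁻¹ (+ 15 / 1) , λ n → ratio-≤ _ _ n {{nonEmpty n}}
  (subst (λ l → 2 *ℕ n *ℕ Crown.S n [] (Crown.vertices n) ≤ℕ (5 *ℕ n +ℕ 30) *ℕ l)
    (sym (length-orderings (Crown.vertices n))) (Crown.total-colours-≤ n))
  where
  nonEmpty : ∀ n → NonZero (length (orderings (Crown.vertices n)))
  nonEmpty n = subst NonZero (sym (length-orderings (Crown.vertices n))) ((n +ℕ n) ℕ.!≢0)
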